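{- Let $G=(V,E)$ be a graph with $n\ge 4$ vertices and maximum degree $\Delta(G)=n-2$. If $|E|=m\ge 2n-4$, then $G$ is antimagic.
   Context: All graphs are finite, undirected and simple; $\Delta(G)$ denotes the maximum degree of $G$. An antimagic labeling of a graph with $m$ edges and $n$ vertices is a bijection from the set of edges to the integers $\{1,\ldots,m\}$ such that all $n$ vertex sums are pairwise distinct, where a vertex sum is the sum of the labels of all edges incident with that vertex (an isolated vertex has vertex sum $0$). A graph is called antimagic if it has an antimagic labeling. -}

module Defs where

open import Data.Bool using (Bool; T)
open import Data.Bool.Properties using (T?; T-irrelevant)
open import Data.Empty using (⊥-elim)
open import Data.Fin using (Fin; toℕ; _<_; _<?_; _≟_)
open import Data.Fin.Properties using (<-irrelevant)
open import Data.List using (List; []; _∷_; allFin; cartesianProduct; filter; length; map; mapMaybe)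
open import Data.List.Extrema.Nat using (max)
open import Data.List.Membership.Propositional using (_∈_)
open import Data.List.Membership.Propositional.Properties using (∈-allFin; ∈-cartesianProduct⁺)
open import Data.List.Relation.Unary.All using (All; []; _∷_)
open import Data.List.Relation.Unary.AllPairs using ([]; _∷_)
open import Data.List.Relation.Unary.Any using (here; there)
open import Data.List.Relation.Unary.Unique.Propositional using (Unique)
open import Data.List.Relation.Unary.Unique.Propositional.Properties using (allFin⁺; cartesianProduct⁺)
open import Data.Maybe using (Maybe; just; nothing)
open import Data.Nat using (ℕ; suc)
open import Data.Nat.ListAction using (sum)
open import Data.Product using (_×_; _,_)
open import Data.Sum using (_⊎_)
open import Function using (_⤖_; Bijection)
open import Function.Definitions using (Injective)
open import Relation.Binary.PropositionalEquality using (_≡_; _≢_; refl; sym; trans; cong₂)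
open import Relation.Nullary using (¬_; Dec; yes; no)
open import Relation.Nullary.Decidable using (_⊎-dec_)

record Graph (n : ℕ) : Set where
  field
    adj       : Fin n → Fin n → Bool
    symmetric : ∀ {u v} → T (adj u v) → T (adj v u)
    loopless  : ∀ {v} → ¬ T (adj v v)

module _ {n : ℕ} (G : Graph n) where
  open Graph G

  -- The unordered edge {u , v} is represented once, by its increasing pair of
  -- endpoints; both proof fields are propositions.
  record Edge : Set where
    constructor edge
    field
      lo hi    : Fin n
      lo<hi    : lo < hi
      adjacent : T (adj lo hi)

  open Edge

  Incident : Fin n → Edge → Set
  Incident v e = v ≡ lo e ⊎ v ≡ hi e

  incident? : ∀ v e → Dec (Incident v e)
  incident? v e = (v ≟ lo e) ⊎-dec (v ≟ hi e)

  toEdge : Fin n × Fin n → Maybe Edge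
  toEdge (u , v) with u <? v | T? (adj u v)
  ... | yes u<v | yes uv = just (edge u v u<v uv)
  ... | yes _   | no _   = nothing
  ... | no _    | _      = nothing

  edges : List Edge
  edges = mapMaybe toEdge (cartesianProduct (allFin n) (allFin n))

  size : ℕ
  size = length edges

  incidentEdges : Fin n → List Edge
  incidentEdges v = filter (incident? v) edges

  degree : Fin n → ℕ
  degree v = length (incidentEdges v)

  Δ : ℕ
  Δ = max 0 (map degree (allFin n))

  -- Fin size stands for {1 , … , size}: the element i is the label 1 + toℕ i.
  Labeling : Set
  Labeling = Edge ⤖ Fin size

  label : Labeling → Edge → ℕ
  label f e = suc (toℕ (Bijection.to f e))

  vertexSum : Labeling → Fin n → ℕ
  vertexSum f v = sum (map (label f) (incidentEdges v))

  record Antimagic : Set where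
    field
      labeling      : Labeling
      distinct-sums : Injective _≡_ _≡_ (vertexSum labeling)

  toEdge-complete : ∀ e → toEdge (lo e , hi e) ≡ just e
  toEdge-complete (edge u v u<v uv) with u <? v | T? (adj u v)
  ... | yes p  | yes q  = cong₂ (λ x y → just (edge u v x y)) (<-irrelevant p u<v) (T-irrelevant q uv)
  ... | yes _  | no ¬uv = ⊥-elim (¬uv uv)
  ... | no u≮v | _      = ⊥-elim (u≮v u<v)

  toEdge-sound : ∀ p {e} → toEdge p ≡ just e → p ≡ (lo e , hi e)
  toEdge-sound (u , v) eq with u <? v | T? (adj u v)
  toEdge-sound (u , v) refl | yes _ | yes _ = refl

  private
    ∈-mapMaybe : ∀ {e} ps → (lo e , hi e) ∈ ps → e ∈ mapMaybe toEdge ps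
    ∈-mapMaybe {e} (p ∷ ps) (here refl) with toEdge p | toEdge-complete e
    ... | just _ | refl = here refl
    ∈-mapMaybe (p ∷ ps) (there i) with toEdge p
    ... | just _  = there (∈-mapMaybe ps i)
    ... | nothing = ∈-mapMaybe ps i

    fresh : ∀ p {e} ps → toEdge p ≡ just e → All (p ≢_) ps → All (e ≢_) (mapMaybe toEdge ps)
    fresh p []       eq []         = []
    fresh p (q ∷ ps) eq (p≢q ∷ ps≢) with toEdge q in eq′
    ... | nothing = fresh p ps eq ps≢
    ... | just _  = (λ { refl → p≢q (trans (toEdge-sound p eq) (sym (toEdge-sound q eq′))) }) ∷ fresh p ps eq ps≢

    mapMaybe-unique : ∀ ps → Unique ps → Unique (mapMaybe toEdge ps)
    mapMaybe-unique []       []         = []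
    mapMaybe-unique (p ∷ ps) (p∉ ∷ uniq) with toEdge p in eq
    ... | nothing = mapMaybe-unique ps uniq
    ... | just _  = fresh p ps eq p∉ ∷ mapMaybe-unique ps uniq

  edges-complete : ∀ e → e ∈ edges
  edges-complete e = ∈-mapMaybe _ (∈-cartesianProduct⁺ (∈-allFin (lo e)) (∈-allFin (hi e)))

  edges-unique : Unique edges
  edges-unique = mapMaybe-unique _ (cartesianProduct⁺ (allFin⁺ n) (allFin⁺ n))

{-# OPTIONS --safe #-}

-- Let v be a vertex of degree k = n − 2 (the hub) and w its only non-neighbour
-- (the rim). If w is isolated, label G − v first and give the largest k labels to
-- the edges at v, in the order of the partial sums of their other endpoints.
--
-- Otherwise fix an edge wa (a is the anchor). The small labels 1, …, l go to the
-- other edges of G − v; the k + 1 largest labels go to wa and the edges at v. Each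
-- vertex x ≠ v now owns one large label, on vx or, for x = w, on wa. Handing these
-- out in the order of the partial sums makes the sums of all x ≠ v distinct. The
-- label of wa also counts towards the partial sum of a, but moving it by one place
-- moves that sum by one, so a consistent order exists. Finally the sum at v exceeds
-- all others, except possibly the one at a when k = 2, which still differs from it.

module Submission where

open import Defs
open import Data.Bool using (T; if_then_else_)
open import Data.Bool.Properties using (T?; T-irrelevant)
open import Data.Empty using (⊥-elim)
open import Data.Fin using (Fin; zero; suc; toℕ; _≟_)
open import Data.Fin.Properties using (<-irrelevant; <-cmp; <-irrefl; <-asym)
open import Data.List using (List; []; _∷_; _++_; length; map; filter; lookup; allFin)
open import Data.List.Extrema.Nat using (xs≤max; argmax-sel)
open import Data.List.Membership.Propositional using (_∈_)
open import Data.List.Membership.Propositional.Properties using (∈-filter⁺; ∈-filter⁻; ∈-++⁺ʳ; ∈-++⁻; ∈-lookup; ∈-map⁺; ∈-map⁻; ∈-allFin; ∉[])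
open import Data.List.Membership.Propositional.Properties.WithK using (unique∧set⇒bag; unique⇒irrelevant)
open import Data.List.Properties using (length-++; length-map; length-tabulate; map-++; map-∘)
open import Data.List.Relation.Binary.BagAndSetEquality using (∼bag⇒↭)
open import Data.List.Relation.Binary.Permutation.Propositional using (_↭_; ↭-refl; ↭-sym; ↭-trans; ↭-prep; module PermutationReasoning)
open import Data.List.Relation.Binary.Permutation.Propositional.Properties using (shift; ∈-resp-↭; All-resp-↭; ↭-length; ++⁺; ++⁺ˡ; ++⁺ʳ; ++-comm; map⁺; filter-↭)
open import Data.List.Relation.Unary.All as All using (All; []; _∷_)
import Data.List.Relation.Unary.All.Properties as AllP
open import Data.List.Relation.Unary.AllPairs as AllPairs using (AllPairs; []; _∷_)
import Data.List.Relation.Unary.AllPairs.Properties as AllPairsP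
open import Data.List.Relation.Unary.Any using (here; there; index)
open import Data.List.Relation.Unary.Any.Properties using (lookup-index)
open import Data.List.Relation.Unary.Linked.Properties using (Linked⇒AllPairs)
open import Data.List.Relation.Unary.Unique.Propositional using (Unique)
import Data.List.Relation.Unary.Unique.Propositional.Properties as Uniq
import Data.List.Sort as Sort
open import Data.Nat using (ℕ; zero; suc; _+_; _*_; _∸_; _≤_; _<_; z≤n; s≤s; s≤s⁻¹; _<?_)
open import Data.Nat.ListAction using (sum)
open import Data.Nat.ListAction.Properties using (sum-↭; sum-++)
open import Data.Nat.Properties hiding (_≟_; <-irrelevant; <-cmp; <-irrefl; <-asym)
open import Data.Nat.Tactic.RingSolver using (solve-∀)
open import Data.Product using (∃₂; ∃; _×_; _,_; proj₁; proj₂)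
open import Data.Sum using (_⊎_; inj₁; inj₂; [_,_])
open import Function using (_∘_; id; mk⇔; _⤖_; Bijection; mk↔ₛ′)
open import Function.Definitions using (Injective)
open import Function.Properties.Inverse using (↔⇒⤖)
open import Relation.Binary.Construct.On using (decTotalOrder)
open import Relation.Binary.Definitions using (DecidableEquality; tri<; tri≈; tri>)
open import Relation.Binary.PropositionalEquality hiding ([_])
open import Relation.Nullary using (¬_; Dec; yes; no; does)
open import Relation.Nullary.Decidable using (¬?)
open import Relation.Unary using (Decidable)

-- Indicators, permutations of lists and weighted sums.

𝟙 : ∀ {p} {P : Set p} → Dec P → ℕ
𝟙 d = if does d then 1 else 0

𝟙-true : ∀ {p} {P : Set p} (d : Dec P) → P → 𝟙 d ≡ 1
𝟙-true (yes _) _ = refl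
𝟙-true (no ¬p) p = ⊥-elim (¬p p)

𝟙-false : ∀ {p} {P : Set p} (d : Dec P) → ¬ P → 𝟙 d ≡ 0
𝟙-false (yes p) ¬p = ⊥-elim (¬p p)
𝟙-false (no _)  _  = refl

module _ {A : Set} where

  unique-set⇒↭ : {xs ys : List A} → Unique xs → Unique ys →
                 (∀ {z} → z ∈ xs → z ∈ ys) → (∀ {z} → z ∈ ys → z ∈ xs) → xs ↭ ys
  unique-set⇒↭ xs! ys! ⊆ ⊇ = ∼bag⇒↭ (unique∧set⇒bag xs! ys! (mk⇔ ⊆ ⊇))

  Unique-resp-↭ : {xs ys : List A} → xs ↭ ys → Unique xs → Unique ys
  Unique-resp-↭ = go
    where
    open import Data.List.Relation.Binary.Permutation.Propositional
    go : {xs ys : List A} → xs ↭ ys → Unique xs → Unique ys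
    go refl u = u
    go (prep x p) (x∉ ∷ u) = All-resp-↭ p x∉ ∷ go p u
    go (swap x y p) ((x≢y ∷ x∉) ∷ y∉ ∷ u) =
      (≢-sym x≢y ∷ All-resp-↭ p y∉) ∷ All-resp-↭ p x∉ ∷ go p u
    go (trans p q) u = go q (go p u)

  Unique-map : ∀ {B : Set} (f : A → B) {xs} → (∀ {x y} → x ∈ xs → y ∈ xs → f x ≡ f y → x ≡ y) →
               Unique xs → Unique (map f xs)
  Unique-map f {[]}     inj []        = []
  Unique-map f {x ∷ xs} inj (x∉ ∷ u) =
    AllP.map⁺ (All.tabulate λ y∈ fx≡fy → All.lookup x∉ y∈ (inj (here refl) (there y∈) fx≡fy))
    ∷ Unique-map f (λ i j → inj (there i) (there j)) u

  filter-split : ∀ {P : A → Set} (P? : Decidable P) xs → filter P? xs ++ filter (¬? ∘ P?) xs ↭ xs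
  filter-split P? []       = ↭-refl
  filter-split P? (x ∷ xs) with P? x
  ... | yes _ = ↭-prep x (filter-split P? xs)
  ... | no  _ = ↭-trans (shift x (filter P? xs) _) (↭-prep x (filter-split P? xs))

  length-filter-𝟙 : ∀ {P : A → Set} (P? : Decidable P) xs → length (filter P? xs) ≡ sum (map (𝟙 ∘ P?) xs)
  length-filter-𝟙 P? []       = refl
  length-filter-𝟙 P? (x ∷ xs) with P? x
  ... | yes _ = cong suc (length-filter-𝟙 P? xs)
  ... | no  _ = length-filter-𝟙 P? xs

  -- If the entries carry consecutive labels from `b` on and `c` tests incidence with a vertex, this
  -- is what the list contributes to the sum at that vertex.
  wsum : (A → ℕ) → ℕ → List A → ℕ
  wsum c b []       = 0
  wsum c b (x ∷ xs) = c x * b + wsum c (suc b) xs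

  wsum-++ : ∀ c b xs ys → wsum c b (xs ++ ys) ≡ wsum c b xs + wsum c (b + length xs) ys
  wsum-++ c b []       ys = cong (λ i → wsum c i ys) (sym (+-identityʳ b))
  wsum-++ c b (x ∷ xs) ys
    rewrite wsum-++ c (suc b) xs ys | +-suc b (length xs) = sym (+-assoc (c x * b) _ _)

  wsum-cong : ∀ {c c′ xs} b → (∀ {x} → x ∈ xs → c x ≡ c′ x) → wsum c b xs ≡ wsum c′ b xs
  wsum-cong {xs = []}     b eq = refl
  wsum-cong {xs = x ∷ xs} b eq =
    cong₂ _+_ (cong (_* b) (eq (here refl))) (wsum-cong (suc b) (eq ∘ there))

  wsum-linear : ∀ c c′ m b xs → wsum (λ x → c x + m * c′ x) b xs ≡ wsum c b xs + m * wsum c′ b xs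
  wsum-linear c c′ m b []       = sym (*-zeroʳ m)
  wsum-linear c c′ m b (x ∷ xs) rewrite wsum-linear c c′ m (suc b) xs =
    rearrange (c x) (c′ x) m b (wsum c (suc b) xs) (wsum c′ (suc b) xs)
    where
    rearrange : ∀ p q m b s t → (p + m * q) * b + (s + m * t) ≡ p * b + s + m * (q * b + t)
    rearrange = solve-∀

  -- The sum of an arithmetic progression, doubled and with the length added on both sides to avoid
  -- division and subtraction.
  wsum-const : ∀ b xs → 2 * wsum (λ _ → 1) b xs + length xs ≡ length xs * (2 * b + length xs)
  wsum-const b []       = refl
  wsum-const b (x ∷ xs) = begin
    2 * (1 * b + s) + suc l          ≡⟨ reassoc b s l ⟩
    (2 * s + l) + suc (2 * b)        ≡⟨ cong (_+ suc (2 * b)) (wsum-const (suc b) xs) ⟩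
    l * (2 * suc b + l) + suc (2 * b) ≡⟨ expand b l ⟩
    suc l * (2 * b + suc l)          ∎
    where
    open ≡-Reasoning
    s = wsum (λ _ → 1) (suc b) xs
    l = length xs
    reassoc : ∀ b s l → 2 * (1 * b + s) + suc l ≡ (2 * s + l) + suc (2 * b)
    reassoc = solve-∀
    expand : ∀ b l → l * (2 * suc b + l) + suc (2 * b) ≡ suc l * (2 * b + suc l)
    expand = solve-∀

  wsum-upper : ∀ c b xs {M} → b + length xs ≤ suc M → wsum c b xs ≤ sum (map c xs) * M
  wsum-upper c b []       le = z≤n
  wsum-upper c b (x ∷ xs) {M} le rewrite +-suc b (length xs) | *-distribʳ-+ M (c x) (sum (map c xs)) =
    +-mono-≤ (*-monoʳ-≤ (c x) (≤-trans (m≤m+n b _) (s≤s⁻¹ le))) (wsum-upper c (suc b) xs le)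

  -- Links `vertexSum`, a sum over incident edges only, with `wsum` over all edges in the order of
  -- their labels.
  wsum-filter : ∀ {P : A → Set} (P? : Decidable P) (g : A → ℕ) b xs →
                (∀ i → g (lookup xs i) ≡ b + toℕ i) →
                sum (map g (filter P? xs)) ≡ wsum (𝟙 ∘ P?) b xs
  wsum-filter P? g b []       eq = refl
  wsum-filter P? g b (x ∷ xs) eq with P? x
  ... | yes _ = cong₂ _+_ (trans (eq zero) refl) (wsum-filter P? g (suc b) xs λ i → trans (eq (suc i)) (+-suc b (toℕ i)))
  ... | no  _ = wsum-filter P? g (suc b) xs λ i → trans (eq (suc i)) (+-suc b (toℕ i))

wsum-map : ∀ {A B : Set} (f : A → B) c b xs → wsum c b (map f xs) ≡ wsum (c ∘ f) b xs
wsum-map f c b []       = refl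
wsum-map f c b (x ∷ xs) = cong (c (f x) * b +_) (wsum-map f c (suc b) xs)

-- Positions of elements in a list.

module Position {A : Set} (_≟_ : DecidableEquality A) where

  δ : A → A → ℕ
  δ x y = 𝟙 (x ≟ y)

  δ-refl : ∀ x → δ x x ≡ 1
  δ-refl x = 𝟙-true (x ≟ x) refl

  δ-≢ : ∀ {x y} → x ≢ y → δ x y ≡ 0
  δ-≢ {x} {y} = 𝟙-false (x ≟ y)

  -- Encoded as a weighted sum so that `wsum-linear` applies. In a list without repetitions it is
  -- `b` plus the index of `x`, or 0 if `x` is absent.
  position : ℕ → List A → A → ℕ
  position b xs x = wsum (δ x) b xs

  position-∉ : ∀ {x} b xs → All (x ≢_) xs → position b xs x ≡ 0
  position-∉     b []       []         = refl
  position-∉ {x} b (y ∷ ys) (x≢y ∷ x∉) rewrite δ-≢ x≢y = position-∉ (suc b) ys x∉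

  position-head : ∀ {x} b xs → All (x ≢_) xs → position b (x ∷ xs) x ≡ b
  position-head {x} b xs x∉ rewrite δ-refl x | position-∉ (suc b) xs x∉ = trans (+-identityʳ _) (+-identityʳ b)

  position-tail : ∀ {x y} b xs → y ≢ x → position b (x ∷ xs) y ≡ position (suc b) xs y
  position-tail b xs y≢x rewrite δ-≢ y≢x = refl

  position-lower : ∀ {x} b xs → x ∈ xs → b ≤ position b xs x
  position-lower {x} b (y ∷ ys) (here refl) rewrite δ-refl x =
    ≤-trans (≤-reflexive (sym (+-identityʳ b))) (m≤m+n (b + 0) _)
  position-lower     b (y ∷ ys) (there i) =
    ≤-trans (≤-trans (n≤1+n b) (position-lower (suc b) ys i)) (m≤n+m _ _)

  position-upper : ∀ {x} b xs → Unique xs → x ∈ xs → position b xs x < b + length xs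
  position-upper b (y ∷ ys) (y∉ ∷ _) (here refl) rewrite position-head b ys y∉ = m<m+n b (s≤s z≤n)
  position-upper b (y ∷ ys) (y∉ ∷ u) (there i)
    rewrite position-tail b ys (≢-sym (All.lookup y∉ i)) | +-suc b (length ys) = position-upper (suc b) ys u i

  position-split : ∀ {x} b xs ys → Unique (xs ++ x ∷ ys) → position b (xs ++ x ∷ ys) x ≡ b + length xs
  position-split b []       ys (x∉ ∷ _) = trans (position-head b ys x∉) (sym (+-identityʳ b))
  position-split b (y ∷ xs) ys (y∉ ∷ u) =
    trans (position-tail b (xs ++ _ ∷ ys) (≢-sym (All.lookup y∉ (∈-++⁺ʳ xs (here refl)))))
      (trans (position-split (suc b) xs ys u) (sym (+-suc b (length xs))))

  -- The keys increase weakly and the positions strictly along the list, so their sums increase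
  -- strictly.
  key+position-injective : ∀ (key : A → ℕ) b {xs} → Unique xs → AllPairs (λ x y → key x ≤ key y) xs →
    ∀ {x y} → x ∈ xs → y ∈ xs → x ≢ y → key x + position b xs x ≢ key y + position b xs y
  key+position-injective key b {z ∷ zs} (z∉ ∷ u) (z≤ ∷ s) = λ where
      (here refl) (here refl) x≢y → ⊥-elim (x≢y refl)
      (here refl) (there j)   _   → <⇒≢ (first< j)
      (there i)   (here refl) _   → ≢-sym (<⇒≢ (first< i))
      (there i)   (there j)   x≢y eq → key+position-injective key (suc b) u s i j x≢y
        (subst₂ (λ m n → key _ + m ≡ key _ + n) (tail i) (tail j) eq)
    where
    tail : ∀ {y} → y ∈ zs → position b (z ∷ zs) y ≡ position (suc b) zs y
    tail i = position-tail b zs (≢-sym (All.lookup z∉ i))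
    first< : ∀ {y} → y ∈ zs → key z + position b (z ∷ zs) z < key y + position b (z ∷ zs) y
    first< i rewrite position-head b zs z∉ | tail i = +-mono-≤-< (All.lookup z≤ i) (position-lower (suc b) zs i)

  position-injective : ∀ b {xs} → Unique xs → ∀ {x y} → x ∈ xs → y ∈ xs → x ≢ y →
                       position b xs x ≢ position b xs y
  position-injective b u = key+position-injective (λ _ → 0) b u (AllPairs.map (λ _ → z≤n) u)

-- Sorting by keys, also when one key depends on a position.

sort-by : ∀ {A : Set} (key : A → ℕ) xs → ∃ λ ys → ys ↭ xs × AllPairs (λ x y → key x ≤ key y) ys
sort-by key xs = sort xs , sort-↭ xs , Linked⇒AllPairs ≤-trans (sort-↗ xs)
  where open Sort (decTotalOrder ≤-decTotalOrder key)

module _ {A : Set} (_≟_ : DecidableEquality A) where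
  open Position _≟_

  -- Inserting w raises the key of a by the position of w, so w is placed among
  -- the other elements first and a goes to the side of w on which it stays.
  sort-around : ∀ (q : A → ℕ) b {w a U} → Unique U → a ∈ U → w ≢ a →
    ∃₂ λ xs ys → xs ++ ys ↭ U
               × AllPairs (λ x y → q x + δ a x * (b + length xs) ≤ q y + δ a y * (b + length xs)) (xs ++ w ∷ ys)
               × (q w ≡ 0 → xs ≡ [])
  sort-around q b {w} {a} {U} U! a∈U w≢a = result
    where
    others = filter (λ x → ¬? (a ≟ x)) U
    low?   = λ x → q x <? q w
    low    = filter low? others
    high   = filter (¬? ∘ low?) others
    c      = length low

    key : ℕ → A → ℕ
    key z x = q x + δ a x * z

    key-a : ∀ z → key z a ≡ q a + z
    key-a z rewrite δ-refl a = cong (q a +_) (+-identityʳ z)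

    key-≢ : ∀ z {x} → a ≢ x → key z x ≡ q x
    key-≢ z {x} a≢x rewrite δ-≢ a≢x = +-identityʳ (q x)

    U↭ : a ∷ low ++ high ↭ U
    U↭ = ↭-trans (↭-prep a (filter-split low? others)) (unique-set⇒↭
      (All.tabulate (λ i → proj₂ (∈-filter⁻ (λ x → ¬? (a ≟ x)) {xs = U} i)) ∷ Uniq.filter⁺ _ U!) U!
      (λ { (here refl) → a∈U ; (there i) → proj₁ (∈-filter⁻ (λ x → ¬? (a ≟ x)) i) })
      back)
      where
      back : ∀ {z} → z ∈ U → z ∈ a ∷ others
      back {z} i with a ≟ z
      ... | yes refl = here refl
      ... | no  a≢z  = there (∈-filter⁺ (λ x → ¬? (a ≟ x)) i a≢z)

    low-spec : All (λ x → a ≢ x × q x < q w) low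
    low-spec = All.tabulate λ i → let j , lt = ∈-filter⁻ low? {xs = others} i in
      proj₂ (∈-filter⁻ (λ x → ¬? (a ≟ x)) {xs = U} j) , lt

    high-spec : All (λ x → a ≢ x × q w ≤ q x) high
    high-spec = All.tabulate λ i → let j , nlt = ∈-filter⁻ (¬? ∘ low?) {xs = others} i in
      proj₂ (∈-filter⁻ (λ x → ¬? (a ≟ x)) {xs = U} j) , ≮⇒≥ nlt

    -- The key of `w` is `q w`, as `w ≢ a`. It separates the keys of `L` from those of `H`, so
    -- sorting each block sorts the whole.
    assemble : ∀ z L H → All (λ x → key z x ≤ q w) L → All (λ x → q w ≤ key z x) H →
      ∃₂ λ xs ys → xs ↭ L × ys ↭ H × AllPairs (λ x y → key z x ≤ key z y) (xs ++ w ∷ ys)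
    assemble z L H L≤ ≤H =
      let xs , xs↭ , xs↗ = sort-by (key z) L
          ys , ys↭ , ys↗ = sort-by (key z) H
          xs≤ = All-resp-↭ (↭-sym xs↭) L≤
          ≤ys = All-resp-↭ (↭-sym ys↭) ≤H
      in xs , ys , xs↭ , ys↭ ,
         AllPairsP.++⁺ xs↗
           (All.map (≤-trans (≤-reflexive (key-≢ z (≢-sym w≢a)))) ≤ys ∷ ys↗)
           (All.map (λ x≤w → ≤-trans x≤w (≤-reflexive (sym (key-≢ z (≢-sym w≢a)))) ∷ All.map (≤-trans x≤w) ≤ys) xs≤)

    low≤ : ∀ z → All (λ x → key z x ≤ q w) low
    low≤ z = All.map (λ (a≢x , lt) → subst (_≤ q w) (sym (key-≢ z a≢x)) (<⇒≤ lt)) low-spec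

    ≤high : ∀ z → All (λ x → q w ≤ key z x) high
    ≤high z = All.map (λ (a≢x , le) → subst (q w ≤_) (sym (key-≢ z a≢x)) le) high-spec

    result : ∃₂ λ xs ys → xs ++ ys ↭ U
           × AllPairs (λ x y → key (b + length xs) x ≤ key (b + length xs) y) (xs ++ w ∷ ys)
           × (q w ≡ 0 → xs ≡ [])
    -- `b + c` is the position of `w` when `a` comes after it. If the key of `a` would then be below
    -- `q w`, `a` goes before `w` instead. This raises the key by one, which the strict inequality
    -- absorbs.
    result with q a + (b + c) <? q w
    ... | no ≮ with assemble (b + c) low (a ∷ high) (low≤ _) (subst (q w ≤_) (sym (key-a _)) (≮⇒≥ ≮) ∷ ≤high _)
    ...   | xs , ys , xs↭ , ys↭ , s =
      xs , ys , ↭-trans (++⁺ xs↭ ys↭) (↭-trans (shift a low high) U↭)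
      , subst (λ l → AllPairs (λ x y → key (b + l) x ≤ key (b + l) y) (xs ++ w ∷ ys)) (sym (↭-length xs↭)) s
      -- `low` is defined by a strict inequality, so it is empty when `q w` is zero.
      , λ qw≡0 → empty xs (All-resp-↭ (↭-sym xs↭) (All.map (λ (_ , lt) → <-≤-trans lt (≤-reflexive qw≡0)) low-spec))
      where
      empty : ∀ xs → All (λ x → q x < 0) xs → xs ≡ []
      empty [] _ = refl
      empty (x ∷ _) (() ∷ _)
    result | yes lt with assemble (b + suc c) (a ∷ low) high
                           (subst (_≤ q w) (sym (trans (key-a _) (trans (cong (q a +_) (+-suc b c)) (+-suc (q a) _)))) lt ∷ low≤ _) (≤high _)
    ...   | xs , ys , xs↭ , ys↭ , s =
      xs , ys , ↭-trans (++⁺ xs↭ ys↭) U↭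
      , subst (λ l → AllPairs (λ x y → key (b + l) x ≤ key (b + l) y) (xs ++ w ∷ ys)) (sym (↭-length xs↭)) s
      , λ qw≡0 → ⊥-elim (n≮0 (<-≤-trans lt (≤-reflexive qw≡0)))

-- Bijections from lists, and auxiliary facts on sums.

index-∈-lookup : ∀ {A : Set} (xs : List A) i → index (∈-lookup {xs = xs} i) ≡ i
index-∈-lookup (x ∷ xs) zero    = refl
index-∈-lookup (x ∷ xs) (suc i) = cong suc (index-∈-lookup xs i)

-- Membership in a list without repetitions has only one proof, so `index` of the given proofs
-- inverts `lookup`.
enumeration : ∀ {A : Set} {xs : List A} {m} → Unique xs → (∀ x → x ∈ xs) → length xs ≡ m → A ⤖ Fin m
enumeration {xs = xs} xs! total refl = ↔⇒⤖ (mk↔ₛ′ (index ∘ total) (lookup xs)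
  (λ i → trans (cong index (unique⇒irrelevant xs! (total (lookup xs i)) (∈-lookup i))) (index-∈-lookup xs i))
  (λ x → sym (lookup-index (total x))))

enumeration-lookup : ∀ {A : Set} {xs : List A} {m} (xs! : Unique xs) (total : ∀ x → x ∈ xs) (eq : length xs ≡ m) i →
                     toℕ (Bijection.to (enumeration xs! total eq) (lookup xs i)) ≡ toℕ i
enumeration-lookup {xs = xs} xs! total refl i =
  cong toℕ (trans (cong index (unique⇒irrelevant xs! (total (lookup xs i)) (∈-lookup i))) (index-∈-lookup xs i))

sum-map-∈ : ∀ {A : Set} (c : A → ℕ) {x xs} → x ∈ xs → c x ≤ sum (map c xs)
sum-map-∈ c (here refl) = m≤m+n _ _
sum-map-∈ c (there i)   = ≤-trans (sum-map-∈ c i) (m≤n+m _ _)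

sum-map-∈² : ∀ {A : Set} (c : A → ℕ) {x y xs} → x ∈ xs → y ∈ xs → x ≢ y → c x + c y ≤ sum (map c xs)
sum-map-∈² c (here refl) (here refl) x≢y = ⊥-elim (x≢y refl)
sum-map-∈² c (here refl) (there j)   _   = +-monoʳ-≤ _ (sum-map-∈ c j)
sum-map-∈² c (there i)   (here refl) _   = ≤-trans (≤-reflexive (+-comm (c _) (c _))) (+-monoʳ-≤ _ (sum-map-∈ c i))
sum-map-∈² c (there i)   (there j)   x≢y = ≤-trans (sum-map-∈² c i j x≢y) (m≤n+m _ _)

wsum-zero : ∀ {A : Set} (c : A → ℕ) b xs → (∀ {x} → x ∈ xs → c x ≡ 0) → wsum c b xs ≡ 0
wsum-zero c b []       eq = refl
wsum-zero c b (x ∷ xs) eq rewrite eq (here refl) = wsum-zero c (suc b) xs (eq ∘ there)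

AllPairs-++-mid : ∀ {A : Set} {R : A → A → Set} {x y : A} xs {ys} → AllPairs R (xs ++ y ∷ ys) → x ∈ xs → R x y
AllPairs-++-mid (x ∷ xs) (r ∷ _)  (here refl) = All.lookup r (∈-++⁺ʳ xs (here refl))
AllPairs-++-mid (x ∷ xs) (_ ∷ rs) (there i)   = AllPairs-++-mid xs rs i

nonempty : ∀ {A : Set} {m} (xs : List A) → length xs ≡ suc m → ∃ (_∈ xs)
nonempty (x ∷ _) _ = x , here refl

empty? : ∀ {A : Set} (xs : List A) → xs ≡ [] ⊎ 0 < length xs
empty? []      = inj₁ refl
empty? (_ ∷ _) = inj₂ (s≤s z≤n)

-- Comparison of the sum at the hub with the other sums.

-- With k = 2 + j spokes, l low labels and z the label at w among the k + 1 top
-- ones, the hypothesis on T says that T is the sum of all top labels.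
module _ {j l T : ℕ} (2T : 2 * T + (3 + j) ≡ (3 + j) * (2 * suc l + (3 + j))) where

  -- The spokes carry all top labels but `z`, so the claim is `X + z < T`. Here `2 * T` equals
  -- `2 * ((3 + j) * l)` plus `12 + 7 * j + j * j`, so only the remainders besides the multiples of
  -- `l` need comparing.
  below-hub : ∀ {V X z} r → V + z ≡ T → X + z ≤ (3 + j) * l + r → 2 * r < 12 + 7 * j + j * j → X < V
  below-hub {V} {X} {z} r V+z≡T X+z≤ r< = +-cancelʳ-< z X V (*-cancelˡ-< 2 _ _ (begin-strict
    2 * (X + z)                             ≤⟨ *-monoʳ-≤ 2 X+z≤ ⟩
    2 * ((3 + j) * l + r)                   ≡⟨ *-distribˡ-+ 2 ((3 + j) * l) r ⟩
    2 * ((3 + j) * l) + 2 * r               <⟨ +-monoʳ-< (2 * ((3 + j) * l)) r< ⟩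
    2 * ((3 + j) * l) + (12 + 7 * j + j * j) ≡⟨ top ⟨
    2 * T                                   ≡⟨ cong (2 *_) V+z≡T ⟨
    2 * (V + z)                             ∎))
    where
    open ≤-Reasoning
    expand : ∀ j l → (3 + j) * (2 * suc l + (3 + j)) ≡ 2 * ((3 + j) * l) + (12 + 7 * j + j * j) + (3 + j)
    expand = solve-∀
    top : 2 * T ≡ 2 * ((3 + j) * l) + (12 + 7 * j + j * j)
    top = +-cancelʳ-≡ (3 + j) _ _ (trans 2T (expand j l))

  -- For ends other than `w` and the anchor: `y` and `z` are distinct, so at most one of them equals
  -- `l + (3 + j)`.
  spoke-end-below : ∀ {V q y z} → V + z ≡ T → q ≤ suc j * l → y ≤ l + (3 + j) → z ≤ l + (3 + j) → y ≢ z → q + y < V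
  spoke-end-below {V} {q} {y} {z} V+z≡T q≤ y≤ z≤ y≢z = below-hub (5 + 2 * j) V+z≡T (begin
      q + y + z                               ≡⟨ +-assoc q y z ⟩
      q + (y + z)                             ≤⟨ +-mono-≤ q≤ (y+z≤ (≤-total y z)) ⟩
      suc j * l + (l + (2 + j) + (l + (3 + j))) ≡⟨ collect j l ⟩
      (3 + j) * l + (5 + 2 * j)               ∎)
    (subst₂ _<_ (sym (lhs j)) (sym (rhs j)) (m<m+n (10 + 4 * j) (s≤s z≤n)))
    where
    open ≤-Reasoning
    collect : ∀ j l → suc j * l + (l + (2 + j) + (l + (3 + j))) ≡ (3 + j) * l + (5 + 2 * j)
    collect = solve-∀
    lhs : ∀ j → 2 * (5 + 2 * j) ≡ 10 + 4 * j
    lhs = solve-∀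
    rhs : ∀ j → 12 + 7 * j + j * j ≡ 10 + 4 * j + suc (1 + 3 * j + j * j)
    rhs = solve-∀
    less : ∀ {m} → m < l + (3 + j) → m ≤ l + (2 + j)
    less m< = s≤s⁻¹ (≤-trans m< (≤-reflexive (+-suc l (2 + j))))
    y+z≤ : y ≤ z ⊎ z ≤ y → y + z ≤ l + (2 + j) + (l + (3 + j))
    y+z≤ (inj₁ y≤z) = +-mono-≤ (less (<-≤-trans (≤∧≢⇒< y≤z y≢z) z≤)) z≤
    y+z≤ (inj₂ z≤y) = ≤-trans (≤-reflexive (+-comm y z)) (+-mono-≤ (less (<-≤-trans (≤∧≢⇒< z≤y (≢-sym y≢z)) y≤)) y≤)

  -- For `w`, whose only top label is `z`. It counts twice, once at `w` and once as the label
  -- missing at the hub.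
  rim-below : ∀ {V q z} → V + z ≡ T → q ≤ suc j * l → z ≤ l + (2 + j) → q + z < V
  rim-below {V} {q} {z} V+z≡T q≤ z≤ = below-hub (4 + 2 * j) V+z≡T (begin
      q + z + z                               ≤⟨ +-mono-≤ (+-mono-≤ q≤ z≤) z≤ ⟩
      suc j * l + (l + (2 + j)) + (l + (2 + j)) ≡⟨ collect j l ⟩
      (3 + j) * l + (4 + 2 * j)               ∎)
    (subst₂ _<_ (sym (lhs j)) (sym (rhs j)) (m<m+n (8 + 4 * j) (s≤s z≤n)))
    where
    open ≤-Reasoning
    collect : ∀ j l → suc j * l + (l + (2 + j)) + (l + (2 + j)) ≡ (3 + j) * l + (4 + 2 * j)
    collect = solve-∀
    lhs : ∀ j → 2 * (4 + 2 * j) ≡ 8 + 4 * j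
    lhs = solve-∀
    rhs : ∀ j → 12 + 7 * j + j * j ≡ 8 + 4 * j + suc (3 + 3 * j + j * j)
    rhs = solve-∀

  -- When `z` may be the largest label, the remainders `12 + 4 * j` and `12 + 7 * j + j * j` tie at
  -- `j = 0`, hence the assumption `0 < j`.
  rim-below-last : ∀ {V q z} → V + z ≡ T → q ≤ suc j * l → z ≤ l + (3 + j) → 0 < j → q + z < V
  rim-below-last {V} {q} {z} V+z≡T q≤ z≤ 0<j = below-hub (6 + 2 * j) V+z≡T (begin
      q + z + z                               ≤⟨ +-mono-≤ (+-mono-≤ q≤ z≤) z≤ ⟩
      suc j * l + (l + (3 + j)) + (l + (3 + j)) ≡⟨ collect j l ⟩
      (3 + j) * l + (6 + 2 * j)               ∎)
    (subst₂ _<_ (sym (lhs j)) (sym (rhs j)) (m<m+n (12 + 4 * j) (≤-trans 0<j (≤-trans (m≤m+n j _) (m≤m+n _ _)))))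
    where
    open ≤-Reasoning
    collect : ∀ j l → suc j * l + (l + (3 + j)) + (l + (3 + j)) ≡ (3 + j) * l + (6 + 2 * j)
    collect = solve-∀
    lhs : ∀ j → 2 * (6 + 2 * j) ≡ 12 + 4 * j
    lhs = solve-∀
    rhs : ∀ j → 12 + 7 * j + j * j ≡ 12 + 4 * j + (3 * j + j * j)
    rhs = solve-∀

  -- The anchor has two top labels, `y` and `z`, which leaves it at most `j` low edges. Here `z` is
  -- the smallest top label.
  anchor-below-first : ∀ {V q y z} → V + z ≡ T → q ≤ j * l → y ≤ l + (3 + j) → z ≡ suc l → q + (y + z) < V
  anchor-below-first {V} {q} {y} {z} V+z≡T q≤ y≤ refl = below-hub (5 + j) V+z≡T (begin
      q + (y + z) + z                         ≤⟨ +-monoˡ-≤ z (+-mono-≤ q≤ (+-monoˡ-≤ z y≤)) ⟩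
      j * l + (l + (3 + j) + suc l) + suc l   ≡⟨ collect j l ⟩
      (3 + j) * l + (5 + j)                   ∎)
    (subst₂ _<_ (sym (lhs j)) (sym (rhs j)) (m<m+n (10 + 2 * j) (s≤s z≤n)))
    where
    open ≤-Reasoning
    collect : ∀ j l → j * l + (l + (3 + j) + suc l) + suc l ≡ (3 + j) * l + (5 + j)
    collect = solve-∀
    lhs : ∀ j → 2 * (5 + j) ≡ 10 + 2 * j
    lhs = solve-∀
    rhs : ∀ j → 12 + 7 * j + j * j ≡ 10 + 2 * j + suc (1 + 5 * j + j * j)
    rhs = solve-∀

  -- For an anchor when `z` is not the largest top label; `h` bounds the low labels at the anchor.
  anchor-below : ∀ {V q y z h} → V + z ≡ T → q ≤ j * h → h < l → y ≤ l + (3 + j) → z ≤ l + (2 + j) →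
                 0 < j → q + (y + z) < V
  anchor-below {V} {q} {y} {z} {h} V+z≡T q≤ h<l y≤ z≤ 0<j = below-hub (7 + 2 * j) V+z≡T (begin
      q + (y + z) + z                                         ≤⟨ +-mono-≤ (+-mono-≤ q≤ (+-mono-≤ y≤ z≤)) z≤ ⟩
      j * h + (l + (3 + j) + (l + (2 + j))) + (l + (2 + j))   ≡⟨ collect j h l ⟩
      -- The inequality `h < l` saves `j` here. The bound `j * l` on `q` would leave the remainder
      -- `7 + 3 * j`, whose double only equals `12 + 7 * j + j * j` at `j = 1`.
      j * suc h + (3 * l + (7 + 2 * j))                       ≤⟨ +-monoˡ-≤ _ (*-monoʳ-≤ j h<l) ⟩
      j * l + (3 * l + (7 + 2 * j))                           ≡⟨ collect′ j l ⟩
      (3 + j) * l + (7 + 2 * j)                               ∎)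
    (slack j 0<j)
    where
    open ≤-Reasoning
    collect : ∀ j h l → j * h + (l + (3 + j) + (l + (2 + j))) + (l + (2 + j)) ≡ j * suc h + (3 * l + (7 + 2 * j))
    collect = solve-∀
    collect′ : ∀ j l → j * l + (3 * l + (7 + 2 * j)) ≡ (3 + j) * l + (7 + 2 * j)
    collect′ = solve-∀
    lhs : ∀ i → 2 * (7 + 2 * suc i) ≡ 18 + 4 * i
    lhs = solve-∀
    rhs : ∀ i → 12 + 7 * suc i + suc i * suc i ≡ 18 + 4 * i + suc (1 + 5 * i + i * i)
    rhs = solve-∀
    slack : ∀ j → 0 < j → 2 * (7 + 2 * j) < 12 + 7 * j + j * j
    slack (suc i) _ = subst₂ _<_ (sym (lhs i)) (sym (rhs i)) (m<m+n (18 + 4 * i) (s≤s z≤n))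

-- With two spokes the top labels are `l + 1`, `l + 2` and `l + 3`, so `T` is three times `z` and
-- `V` twice `z`. Equality would force `y ≡ z`.
anchor-distinct : ∀ {l T V y z} → 2 * T + 3 ≡ 3 * (2 * suc l + 3) → V + z ≡ T → z ≡ l + 2 → y ≢ z → y + z ≢ V
anchor-distinct {l} {T} {V} {y} {z} 2T V+z≡T refl y≢z refl =
  y≢z (+-cancelʳ-≡ (z + z) _ _ (*-cancelˡ-≡ _ _ 2 (+-cancelʳ-≡ 3 _ _ (begin
    2 * (y + (z + z)) + 3     ≡⟨ cong (λ s → 2 * s + 3) (trans (sym (+-assoc y z z)) V+z≡T) ⟩
    2 * T + 3                 ≡⟨ 2T ⟩
    3 * (2 * suc l + 3)       ≡⟨ expand l ⟩
    2 * (z + (z + z)) + 3     ∎))))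
  where
  open ≡-Reasoning
  expand : ∀ l → 3 * (2 * suc l + 3) ≡ 2 * (l + 2 + (l + 2 + (l + 2))) + 3
  expand = solve-∀

-- The comparison for isolated `w`: there are only `2 + j` top labels, and the hub carries all of
-- them.
star-only-below : ∀ {j l V q y} → 2 * V + (2 + j) ≡ (2 + j) * (2 * suc l + (2 + j)) →
                  q ≤ suc j * l → y ≤ l + (2 + j) → q + y < V
star-only-below {j} {l} {V} {q} {y} 2V q≤ y≤ = *-cancelˡ-< 2 _ _ (+-cancelʳ-< (2 + j) _ _ (begin-strict
    2 * (q + y) + (2 + j)                         ≤⟨ +-monoˡ-≤ _ (*-monoʳ-≤ 2 (+-mono-≤ q≤ y≤)) ⟩
    2 * (suc j * l + (l + (2 + j))) + (2 + j)     <⟨ m<m+n _ (s≤s z≤n) ⟩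
    2 * (suc j * l + (l + (2 + j))) + (2 + j) + suc (1 + 3 * j + j * j) ≡⟨ expand j l ⟩
    (2 + j) * (2 * suc l + (2 + j))               ≡⟨ 2V ⟨
    2 * V + (2 + j)                               ∎))
  where
  open ≤-Reasoning
  expand : ∀ j l → 2 * (suc j * l + (l + (2 + j))) + (2 + j) + suc (1 + 3 * j + j * j) ≡ (2 + j) * (2 * suc l + (2 + j))
  expand = solve-∀

-- Edges and incidence in a simple graph.

module _ {n : ℕ} (G : Graph n) where
  open Graph G
  open Edge

  private
    V = Fin n
    E = Edge G

  edge-≡ : ∀ {e e′ : E} → lo e ≡ lo e′ → hi e ≡ hi e′ → e ≡ e′
  edge-≡ {edge u v p q} {edge _ _ p′ q′} refl refl = cong₂ (edge u v) (<-irrelevant p p′) (T-irrelevant q q′)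

  incident-only : ∀ {x y z} {e : E} → x ≢ y → Incident G x e → Incident G y e → Incident G z e → z ≡ x ⊎ z ≡ y
  incident-only x≢y (inj₁ refl) (inj₁ refl) _           = ⊥-elim (x≢y refl)
  incident-only x≢y (inj₂ refl) (inj₂ refl) _           = ⊥-elim (x≢y refl)
  incident-only x≢y (inj₁ refl) (inj₂ refl) z∈          = z∈
  incident-only x≢y (inj₂ refl) (inj₁ refl) (inj₁ refl) = inj₂ refl
  incident-only x≢y (inj₂ refl) (inj₁ refl) (inj₂ refl) = inj₁ refl

  incident-unique : ∀ {x y} {e e′ : E} → x ≢ y → Incident G x e → Incident G y e →
                    Incident G x e′ → Incident G y e′ → e ≡ e′
  incident-unique x≢y (inj₁ refl) (inj₁ refl) _ _ = ⊥-elim (x≢y refl)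
  incident-unique x≢y (inj₂ refl) (inj₂ refl) _ _ = ⊥-elim (x≢y refl)
  incident-unique x≢y _ _ (inj₁ refl) (inj₁ refl) = ⊥-elim (x≢y refl)
  incident-unique x≢y _ _ (inj₂ refl) (inj₂ refl) = ⊥-elim (x≢y refl)
  incident-unique x≢y (inj₁ p) (inj₂ q) (inj₁ p′) (inj₂ q′) = edge-≡ (trans (sym p) p′) (trans (sym q) q′)
  incident-unique x≢y (inj₂ p) (inj₁ q) (inj₂ p′) (inj₁ q′) = edge-≡ (trans (sym q) q′) (trans (sym p) p′)
  -- From here on the two edges list the endpoints in opposite orders, which `lo<hi` forbids.
  incident-unique {e = e} {e′} x≢y (inj₁ refl) (inj₂ refl) (inj₂ p′) (inj₁ q′) =
    ⊥-elim (<-asym (lo<hi e) (subst₂ Data.Fin._<_ (sym q′) (sym p′) (lo<hi e′)))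
  incident-unique {e = e} {e′} x≢y (inj₂ refl) (inj₁ refl) (inj₁ p′) (inj₂ q′) =
    ⊥-elim (<-asym (lo<hi e) (subst₂ Data.Fin._<_ (sym p′) (sym q′) (lo<hi e′)))

  other-endpoint : ∀ {x} {e : E} → Incident G x e → ∃ λ y → x ≢ y × Incident G y e × T (adj x y)
  other-endpoint {e = e} (inj₁ refl) = hi e , (λ eq → <-irrefl eq (lo<hi e)) , inj₂ refl , adjacent e
  other-endpoint {e = e} (inj₂ refl) = lo e , (λ eq → <-irrefl (sym eq) (lo<hi e)) , inj₁ refl , symmetric (adjacent e)

  adjacent-≢ : ∀ {x y} → T (adj x y) → x ≢ y
  adjacent-≢ xy refl = loopless xy

  join : ∀ {x y} → T (adj x y) → ∃ λ e → Incident G x e × Incident G y e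
  join {x} {y} xy with <-cmp x y
  ... | tri< x<y _ _ = edge x y x<y xy , inj₁ refl , inj₂ refl
  ... | tri≈ _ x≡y _ = ⊥-elim (adjacent-≢ xy x≡y)
  ... | tri> _ _ y<x = edge y x y<x (symmetric xy) , inj₂ refl , inj₁ refl

  inc : V → E → ℕ
  inc x e = 𝟙 (incident? G x e)

  degree-↭ : ∀ {es} → es ↭ edges G → ∀ x → sum (map (inc x) es) ≡ degree G x
  degree-↭ es↭ x = trans (sum-↭ (map⁺ (inc x) es↭)) (sym (length-filter-𝟙 (incident? G x) (edges G)))

  -- Numbering the edges along `es` from 1 on is a labeling, and its vertex sums are these weighted
  -- sums.
  ordering⇒antimagic : ∀ {es} → es ↭ edges G → Injective _≡_ _≡_ (λ x → wsum (inc x) 1 es) → Antimagic G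
  ordering⇒antimagic {es} es↭ inj = record
    { labeling      = f
    ; distinct-sums = λ {x} {y} eq → inj (trans (sym (sums x)) (trans eq (sums y)))
    }
    where
    es!   = Unique-resp-↭ (↭-sym es↭) (edges-unique G)
    total = λ e → ∈-resp-↭ (↭-sym es↭) (edges-complete G e)
    f : Labeling G
    f = enumeration es! total (↭-length es↭)

    sums : ∀ x → vertexSum G f x ≡ wsum (inc x) 1 es
    sums x = trans (sum-↭ (map⁺ (label G f) (filter-↭ (incident? G x) (↭-sym es↭))))
      (wsum-filter (incident? G x) (label G f) 1 es λ i → cong suc (enumeration-lookup es! total (↭-length es↭) i))

  -- The edges at the hub and its non-neighbour.

  module Spokes (v : V) (e∘ : E) where

    neighbours : List V
    neighbours = filter (λ x → T? (adj v x)) (allFin n)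

    neighbours! : Unique neighbours
    neighbours! = Uniq.filter⁺ _ (Uniq.allFin⁺ n)

    ∈-neighbours⁺ : ∀ {x} → T (adj v x) → x ∈ neighbours
    ∈-neighbours⁺ {x} = ∈-filter⁺ (λ x → T? (adj v x)) (∈-allFin x)

    ∈-neighbours⁻ : ∀ {x} → x ∈ neighbours → T (adj v x)
    ∈-neighbours⁻ i = proj₂ (∈-filter⁻ (λ x → T? (adj v x)) {xs = allFin n} i)

    -- With e∘ = wa this is the edge carrying the large label of x, also for x = w.
    spoke : V → E
    spoke x with T? (adj v x)
    ... | yes vx = proj₁ (join vx)
    ... | no  _  = e∘

    spoke-incident : ∀ {x} → T (adj v x) → Incident G v (spoke x) × Incident G x (spoke x)
    spoke-incident {x} vx with T? (adj v x)
    ... | yes vx′ = proj₂ (join vx′)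
    ... | no ¬vx  = ⊥-elim (¬vx vx)

    spoke-default : ∀ {x} → ¬ T (adj v x) → spoke x ≡ e∘
    spoke-default {x} ¬vx with T? (adj v x)
    ... | yes vx = ⊥-elim (¬vx vx)
    ... | no  _  = refl

    -- An edge at `v` has exactly one other endpoint, and by simplicity it is determined by that
    -- endpoint.
    spokes-↭ : map spoke neighbours ↭ incidentEdges G v
    spokes-↭ = unique-set⇒↭ (Unique-map spoke inj neighbours!) (Uniq.filter⁺ _ (edges-unique G)) fwd bwd
      where
      inj : ∀ {x y} → x ∈ neighbours → y ∈ neighbours → spoke x ≡ spoke y → x ≡ y
      inj {x} {y} i j eq with spoke-incident (∈-neighbours⁻ i) | spoke-incident (∈-neighbours⁻ j)
      ... | v∈x , x∈x | _ , y∈y with incident-only {e = spoke x} (adjacent-≢ (∈-neighbours⁻ i)) v∈x x∈x (subst (Incident G y) (sym eq) y∈y)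
      ...   | inj₁ y≡v = ⊥-elim (adjacent-≢ (∈-neighbours⁻ j) (sym y≡v))
      ...   | inj₂ y≡x = sym y≡x
      fwd : ∀ {e} → e ∈ map spoke neighbours → e ∈ incidentEdges G v
      fwd i with x , x∈ , refl ← ∈-map⁻ spoke i =
        ∈-filter⁺ (incident? G v) (edges-complete G _) (proj₁ (spoke-incident (∈-neighbours⁻ x∈)))
      bwd : ∀ {e} → e ∈ incidentEdges G v → e ∈ map spoke neighbours
      bwd {e} i with _ , v∈e ← ∈-filter⁻ (incident? G v) {xs = edges G} i
        with y , v≢y , y∈e , vy ← other-endpoint {e = e} v∈e
        with v∈s , y∈s ← spoke-incident vy =
        subst (_∈ _) (incident-unique v≢y v∈s y∈s v∈e y∈e) (∈-map⁺ spoke (∈-neighbours⁺ vy))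

    degree-neighbours : degree G v ≡ length neighbours
    degree-neighbours = trans (sym (↭-length spokes-↭)) (length-map spoke neighbours)

    -- Counting leaves exactly two vertices not adjacent to `v`, and `v` itself is one of them by
    -- looplessness.
    sole-non-neighbour : n ≡ 2 + degree G v →
      ∃ λ w → v ≢ w × ¬ T (adj v w) × (∀ x → x ≡ v ⊎ x ≡ w ⊎ T (adj v x))
    sole-non-neighbour n≡ = pick non (Uniq.filter⁺ _ (Uniq.allFin⁺ n)) length-non
        (λ ¬vx → ∈-filter⁺ (λ x → ¬? (T? (adj v x))) (∈-allFin _) ¬vx)
        (λ i → proj₂ (∈-filter⁻ (λ x → ¬? (T? (adj v x))) {xs = allFin n} i))
      where
      non = filter (λ x → ¬? (T? (adj v x))) (allFin n)

      length-non : length non ≡ 2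
      length-non = +-cancelˡ-≡ (length neighbours) _ _ (begin
        length neighbours + length non   ≡⟨ length-++ neighbours ⟨
        length (neighbours ++ non)       ≡⟨ ↭-length (filter-split (λ x → T? (adj v x)) (allFin n)) ⟩
        length (allFin n)                ≡⟨ length-tabulate {n = n} id ⟩
        n                                ≡⟨ n≡ ⟩
        2 + degree G v                   ≡⟨ +-comm 2 _ ⟩
        degree G v + 2                   ≡⟨ cong (_+ 2) degree-neighbours ⟩
        length neighbours + 2            ∎)
        where open ≡-Reasoning

      pick : ∀ xs → Unique xs → length xs ≡ 2 →
             (∀ {x} → ¬ T (adj v x) → x ∈ xs) → (∀ {x} → x ∈ xs → ¬ T (adj v x)) →
             ∃ λ w → v ≢ w × ¬ T (adj v w) × (∀ x → x ≡ v ⊎ x ≡ w ⊎ T (adj v x))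
      pick (x ∷ y ∷ []) ((x≢y ∷ []) ∷ _) refl ⊇ ⊆ with ⊇ {v} loopless
      ... | here refl = y , x≢y , ⊆ (there (here refl)) , cover
        where
        cover : ∀ z → z ≡ x ⊎ z ≡ y ⊎ T (adj x z)
        cover z with T? (adj x z)
        ... | yes vz = inj₂ (inj₂ vz)
        ... | no ¬vz with ⊇ ¬vz
        ...   | here eq         = inj₁ eq
        ...   | there (here eq) = inj₂ (inj₁ eq)
      ... | there (here refl) = x , ≢-sym x≢y , ⊆ (here refl) , cover
        where
        cover : ∀ z → z ≡ y ⊎ z ≡ x ⊎ T (adj y z)
        cover z with T? (adj y z)
        ... | yes vz = inj₂ (inj₂ vz)
        ... | no ¬vz with ⊇ ¬vz
        ...   | here eq         = inj₂ (inj₁ eq)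
        ...   | there (here eq) = inj₁ eq

  max-degree-attained : 0 < Δ G → ∃ λ v → degree G v ≡ Δ G
  max-degree-attained Δ>0 with argmax-sel id 0 (map (degree G) (allFin n))
  -- This is the default value 0 of `max`, excluded by positivity.
  ... | inj₁ Δ≡0 = ⊥-elim (<⇒≢ Δ>0 (sym Δ≡0))
  ... | inj₂ Δ∈  with v , _ , eq ← ∈-map⁻ (degree G) Δ∈ = v , sym eq

  degree≤Δ : ∀ x → degree G x ≤ Δ G
  degree≤Δ x = All.lookup (xs≤max 0 (map (degree G) (allFin n))) (∈-map⁺ (degree G) (∈-allFin x))

-- Common setting of the two constructions.

module Labelings {n : ℕ} (G : Graph n) {j : ℕ} {v w : Fin n}
  (deg-v : degree G v ≡ 2 + j) (deg≤ : ∀ x → degree G x ≤ 2 + j)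
  (v≢w : v ≢ w) (¬vw : ¬ T (Graph.adj G v w))
  (cover : ∀ x → x ≡ v ⊎ x ≡ w ⊎ T (Graph.adj G v x))
  where
  open Graph G
  open Position {Fin n} _≟_

  private
    I = inc G

  avoiding-hub : List (Edge G)
  avoiding-hub = filter (λ e → ¬? (incident? G v e)) (edges G)

  avoids-hub : ∀ {e} → e ∈ avoiding-hub → ¬ Incident G v e
  avoids-hub i = proj₂ (∈-filter⁻ (λ e → ¬? (incident? G v e)) {xs = edges G} i)

  hub-split : incidentEdges G v ++ avoiding-hub ↭ edges G
  hub-split = filter-split (incident? G v) (edges G)

  -- No degree exceeds `2 + j`, so every edge at `x` in `top` lowers the bound on those in `low`.
  count-low : ∀ low top → low ++ top ↭ edges G → ∀ x m → 2 + j ≤ sum (map (I x) top) + m →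
              sum (map (I x) low) ≤ m
  count-low low top es↭ x m le = +-cancelʳ-≤ (sum (map (I x) top)) _ _ (begin
    sum (map (I x) low) + sum (map (I x) top) ≡⟨ sum-++ (map (I x) low) _ ⟨
    sum (map (I x) low ++ map (I x) top)      ≡⟨ cong sum (map-++ (I x) low top) ⟨
    sum (map (I x) (low ++ top))              ≡⟨ degree-↭ G es↭ x ⟩
    degree G x                                ≤⟨ deg≤ x ⟩
    2 + j                                     ≤⟨ le ⟩
    sum (map (I x) top) + m                   ≡⟨ +-comm _ m ⟩
    m + sum (map (I x) top)                   ∎)
    where
    open ≤-Reasoning

  -- The case of an isolated rim.

  isolated⇒antimagic : Edge G → (∀ e → ¬ Incident G w e) → Antimagic G
  isolated⇒antimagic e∘ w-isolated = ordering⇒antimagic G es↭ (λ {x} {y} → injective x y)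
    where
    open Spokes G v e∘
    low : List (Edge G)
    low = avoiding-hub
    l : ℕ
    l = length low
    q : Fin n → ℕ
    q x = wsum (I x) 1 low
    sorted = sort-by q neighbours
    σ : List (Fin n)
    σ   = proj₁ sorted
    σ↭ : σ ↭ neighbours
    σ↭  = proj₁ (proj₂ sorted)
    σ!  = Unique-resp-↭ (↭-sym σ↭) neighbours!
    es : List (Edge G)
    es = low ++ map spoke σ
    S pos : Fin n → ℕ
    S x = wsum (I x) 1 es
    pos = position (suc l) σ

    ∈σ⁻ : ∀ {x} → x ∈ σ → T (adj v x)
    ∈σ⁻ i = ∈-neighbours⁻ (∈-resp-↭ σ↭ i)

    length-σ : length σ ≡ 2 + j
    length-σ = trans (↭-length σ↭) (trans (sym degree-neighbours) deg-v)

    es↭ : es ↭ edges G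
    es↭ = ↭-trans (++-comm low _) (↭-trans (++⁺ʳ low (↭-trans (map⁺ spoke σ↭) spokes-↭)) hub-split)

    S-split : ∀ x → S x ≡ q x + wsum (I x ∘ spoke) (suc l) σ
    S-split x = trans (wsum-++ (I x) 1 low (map spoke σ)) (cong (q x +_) (wsum-map spoke (I x) (suc l) σ))

    S-end : ∀ {x} → x ≢ v → S x ≡ q x + pos x
    S-end {x} x≢v = trans (S-split x) (cong (q x +_) (wsum-cong (suc l) at))
      where
      at : ∀ {y} → y ∈ σ → I x (spoke y) ≡ δ x y
      at {y} i with v∈ , y∈ ← spoke-incident (∈σ⁻ i) with x ≟ y
      ... | yes refl = 𝟙-true (incident? G x (spoke y)) y∈
      ... | no x≢y = 𝟙-false (incident? G x (spoke y)) λ x∈ →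
          [ x≢v , x≢y ] (incident-only G {e = spoke y} (adjacent-≢ G (∈σ⁻ i)) v∈ y∈ x∈)

    S-hub : 2 * S v + (2 + j) ≡ (2 + j) * (2 * suc l + (2 + j))
    S-hub = subst₂ (λ s k → 2 * s + k ≡ k * (2 * suc l + k)) (sym S-v) length-σ (wsum-const (suc l) σ)
      where
      S-v : S v ≡ wsum (λ _ → 1) (suc l) σ
      S-v = trans (S-split v) (cong₂ _+_
        (wsum-zero (I v) 1 low (λ {e} i → 𝟙-false (incident? G v e) (avoids-hub i)))
        (wsum-cong (suc l) λ {x} i → 𝟙-true (incident? G v (spoke x)) (proj₁ (spoke-incident (∈σ⁻ i)))))

    S-w : S w ≡ 0
    S-w = wsum-zero (I w) 1 es λ {e} _ → 𝟙-false (incident? G w e) (w-isolated e)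

    end : ∀ {x} → T (adj v x) → x ∈ σ
    end vx = ∈-resp-↭ (↭-sym σ↭) (∈-neighbours⁺ vx)

    end<hub : ∀ {x} → T (adj v x) → S x < S v
    end<hub {x} vx = subst (_< S v) (sym (S-end (≢-sym (adjacent-≢ G vx))))
      (star-only-below S-hub
        -- The spoke of `x` is a top edge, which leaves at most `suc j` low edges at `x`, each with
        -- label at most `l`.
        (≤-trans (wsum-upper (I x) 1 low ≤-refl) (*-monoˡ-≤ l (count-low low (map spoke σ) es↭ x (suc j)
          (+-monoˡ-≤ (suc j) (≤-trans (≤-reflexive (sym (𝟙-true (incident? G x (spoke x)) (proj₂ (spoke-incident vx)))))
             (sum-map-∈ (I x) (∈-map⁺ spoke (end vx))))))))
        (s≤s⁻¹ (subst (λ k → pos x < suc l + k) length-σ (position-upper (suc l) σ σ! (end vx)))))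

    0<end : ∀ {x} → T (adj v x) → 0 < S x
    0<end {x} vx = subst (0 <_) (sym (S-end (≢-sym (adjacent-≢ G vx))))
      (≤-trans (s≤s z≤n) (≤-trans (position-lower (suc l) σ (end vx)) (m≤n+m _ (q x))))

    0<hub : 0 < S v
    0<hub = <-trans (0<end vx) (end<hub vx)
      where vx = ∈σ⁻ (proj₂ (nonempty σ length-σ))

    -- The sums fall into three ranges: zero at `w`, positive and increasing along `σ`, and larger
    -- than all of these at `v`.
    injective : ∀ x y → S x ≡ S y → x ≡ y
    injective x y eq with cover x | cover y
    ... | inj₁ refl | inj₁ refl = refl
    ... | inj₁ refl | inj₂ (inj₁ refl) = ⊥-elim (<⇒≢ 0<hub (sym (trans eq S-w)))
    ... | inj₁ refl | inj₂ (inj₂ vy) = ⊥-elim (<⇒≢ (end<hub vy) (sym eq))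
    ... | inj₂ (inj₁ refl) | inj₁ refl = ⊥-elim (<⇒≢ 0<hub (sym (trans (sym eq) S-w)))
    ... | inj₂ (inj₁ refl) | inj₂ (inj₁ refl) = refl
    ... | inj₂ (inj₁ refl) | inj₂ (inj₂ vy) = ⊥-elim (<⇒≢ (0<end vy) (sym (trans (sym eq) S-w)))
    ... | inj₂ (inj₂ vx) | inj₁ refl = ⊥-elim (<⇒≢ (end<hub vx) eq)
    ... | inj₂ (inj₂ vx) | inj₂ (inj₁ refl) = ⊥-elim (<⇒≢ (0<end vx) (sym (trans eq S-w)))
    ... | inj₂ (inj₂ vx) | inj₂ (inj₂ vy) with x ≟ y
    ...   | yes x≡y = x≡y
    ...   | no x≢y = ⊥-elim (key+position-injective q (suc l) σ! (proj₂ (proj₂ sorted)) (end vx) (end vy) x≢y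
              (trans (sym (S-end (≢-sym (adjacent-≢ G vx)))) (trans eq (S-end (≢-sym (adjacent-≢ G vy))))))

  -- The case of a rim with an edge to the anchor.

  module _ {a : Fin n} {e∘ : Edge G} (w≢a : w ≢ a) (w∈e∘ : Incident G w e∘) (a∈e∘ : Incident G a e∘) (va : T (adj v a)) where
    open Spokes G v e∘

    private
      rim-edges inner rim-rest low : List (Edge G)
      rim-edges = filter (incident? G w) avoiding-hub
      inner     = filter (λ e → ¬? (incident? G w e)) avoiding-hub
      rim-rest  = filter (λ e → ¬? (incident? G a e)) rim-edges
      -- The edges at w come last so that the labels at a stay below l if w has another
      -- edge; for k = 3 the sum at a could otherwise equal the one at v.
      low       = inner ++ rim-rest
      l b : ℕ
      l = length low
      b = suc l
      q : Fin n → ℕ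
      q x = wsum (I x) 1 low

    v∉e∘ : ¬ Incident G v e∘
    v∉e∘ v∈ with incident-only G {e = e∘} w≢a w∈e∘ a∈e∘ v∈
    ... | inj₁ v≡w = v≢w v≡w
    ... | inj₂ v≡a = adjacent-≢ G va v≡a

    -- By simplicity `e∘` is the only edge joining `w` and `a`, so dropping the edges at `a` drops
    -- just this one.
    rim-split : e∘ ∷ rim-rest ↭ rim-edges
    rim-split = ↭-trans (++⁺ʳ rim-rest (↭-sym sole)) (filter-split (incident? G a) rim-edges)
      where
      sole : filter (incident? G a) rim-edges ↭ e∘ ∷ []
      sole = unique-set⇒↭ (Uniq.filter⁺ _ (Uniq.filter⁺ _ (Uniq.filter⁺ _ (edges-unique G)))) ([] ∷ []) fwd bwd
        where
        fwd : ∀ {e} → e ∈ filter (incident? G a) rim-edges → e ∈ e∘ ∷ []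
        fwd {e} i with i′ , a∈e ← ∈-filter⁻ (incident? G a) {xs = rim-edges} i
          with _ , w∈e ← ∈-filter⁻ (incident? G w) {xs = avoiding-hub} i′ =
          here (incident-unique G {e = e} {e∘} w≢a w∈e a∈e w∈e∘ a∈e∘)
        bwd : ∀ {e} → e ∈ e∘ ∷ [] → e ∈ filter (incident? G a) rim-edges
        bwd (here refl) = ∈-filter⁺ (incident? G a) (∈-filter⁺ (incident? G w)
          (∈-filter⁺ (λ e → ¬? (incident? G v e)) (edges-complete G e∘) v∉e∘) w∈e∘) a∈e∘

    -- The spoke of `w` is `e∘`, so the list consists of the edges at `v`, those at `w` and the
    -- remaining ones, each once.
    ordering-↭ : ∀ {σ} → σ ↭ w ∷ neighbours → low ++ map spoke σ ↭ edges G
    ordering-↭ {σ} σ↭ = begin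
      low ++ map spoke σ                                  ↭⟨ ++⁺ˡ low (map⁺ spoke σ↭) ⟩
      low ++ spoke w ∷ map spoke neighbours               ↭⟨ ++-comm low _ ⟩
      spoke w ∷ map spoke neighbours ++ low               ≡⟨ cong (_∷ map spoke neighbours ++ low) (spoke-default ¬vw) ⟩
      e∘ ∷ map spoke neighbours ++ low                    ↭⟨ shift e∘ (map spoke neighbours) low ⟨
      map spoke neighbours ++ e∘ ∷ inner ++ rim-rest        ↭⟨ ++⁺ spokes-↭ (↭-prep e∘ (++-comm inner rim-rest)) ⟩
      incidentEdges G v ++ (e∘ ∷ rim-rest) ++ inner         ↭⟨ ++⁺ˡ (incidentEdges G v) (++⁺ʳ inner rim-split) ⟩
      incidentEdges G v ++ rim-edges ++ inner             ↭⟨ ++⁺ˡ (incidentEdges G v) (filter-split (incident? G w) avoiding-hub) ⟩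
      incidentEdges G v ++ avoiding-hub                   ↭⟨ hub-split ⟩
      edges G                                             ∎
      where open PermutationReasoning

    -- Sums for the order `A`, `w`, `B` of the large labels.

    module Arranged (A B : List (Fin n)) (AB↭ : A ++ B ↭ neighbours)
      (σ↗ : AllPairs (λ x y → q x + δ a x * (b + length A) ≤ q y + δ a y * (b + length A)) (A ++ w ∷ B))
      (qw≡0⇒A≡[] : q w ≡ 0 → A ≡ []) where

      σ : List (Fin n)
      σ = A ++ w ∷ B

      -- The partial sum of `x` before its own large label is added; that of `a` includes the label
      -- `b + length A` of `e∘`.
      key : Fin n → ℕ
      key x = q x + δ a x * (b + length A)

      σ↭ : σ ↭ w ∷ neighbours
      σ↭ = ↭-trans (shift w A B) (↭-prep w AB↭)

      σ! : Unique σ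
      σ! = Unique-resp-↭ (↭-sym σ↭)
        (All.tabulate (λ i w≡x → ¬vw (subst (T ∘ adj v) (sym w≡x) (∈-neighbours⁻ i))) ∷ neighbours!)

      length-neighbours : length neighbours ≡ 2 + j
      length-neighbours = trans (sym degree-neighbours) deg-v

      length-AB : length A + length B ≡ 2 + j
      length-AB = trans (sym (length-++ A)) (trans (↭-length AB↭) length-neighbours)

      length-σ : length σ ≡ 3 + j
      length-σ = trans (↭-length σ↭) (cong suc length-neighbours)

      es : List (Edge G)
      es = low ++ map spoke σ

      es↭ : es ↭ edges G
      es↭ = ordering-↭ σ↭

      S pos : Fin n → ℕ
      S x = wsum (I x) 1 es
      pos = position b σ

      w∈σ : w ∈ σ
      w∈σ = ∈-++⁺ʳ A (here refl)

      end : ∀ {x} → T (adj v x) → x ∈ σ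
      end vx = ∈-resp-↭ (↭-sym σ↭) (there (∈-neighbours⁺ vx))

      ∈σ⁻ : ∀ {x} → x ∈ σ → x ≡ w ⊎ T (adj v x)
      ∈σ⁻ i with ∈-resp-↭ σ↭ i
      ... | here eq = inj₁ eq
      ... | there i′ = inj₂ (∈-neighbours⁻ i′)

      v≢σ : ∀ {x} → x ∈ σ → x ≢ v
      v≢σ i refl with ∈σ⁻ i
      ... | inj₁ v≡w = v≢w v≡w
      ... | inj₂ vv  = loopless vv

      pos-w : pos w ≡ b + length A
      pos-w = position-split b A B σ!

      S-split : ∀ x → S x ≡ q x + wsum (I x ∘ spoke) b σ
      S-split x = trans (wsum-++ (I x) 1 low (map spoke σ)) (cong (q x +_) (wsum-map spoke (I x) b σ))

      -- Apart from `v`, the spoke of `y` meets only `y`, except that `e∘`, the spoke of `w`, also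
      -- meets `a`. The product form suits `wsum-linear`.
      inc-spoke : ∀ {x y} → x ≢ v → y ∈ σ → I x (spoke y) ≡ δ x y + δ a x * δ w y
      inc-spoke {x} {y} x≢v y∈ with ∈σ⁻ y∈
      ... | inj₂ vy with v∈ , y∈s ← spoke-incident vy
        rewrite δ-≢ {w} {y} (λ { refl → ¬vw vy }) | *-zeroʳ (δ a x) | +-identityʳ (δ x y) with x ≟ y
      ...   | yes refl = 𝟙-true (incident? G x (spoke y)) y∈s
      ...   | no x≢y = 𝟙-false (incident? G x (spoke y)) λ x∈ →
          [ x≢v , x≢y ] (incident-only G {e = spoke y} (adjacent-≢ G vy) v∈ y∈s x∈)
      inc-spoke {x} {y} x≢v y∈ | inj₁ refl rewrite spoke-default ¬vw | δ-refl w | *-identityʳ (δ a x) with x ≟ w | a ≟ x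
      ... | yes refl | yes a≡w  = ⊥-elim (w≢a (sym a≡w))
      ... | yes refl | no _     = 𝟙-true (incident? G w e∘) w∈e∘
      ... | no _     | yes refl = 𝟙-true (incident? G a e∘) a∈e∘
      ... | no x≢w   | no a≢x   = 𝟙-false (incident? G x e∘) λ x∈ →
          [ x≢w , a≢x ∘ sym ] (incident-only G {e = e∘} w≢a w∈e∘ a∈e∘ x∈)

      S-σ : ∀ {x} → x ∈ σ → S x ≡ q x + (pos x + δ a x * pos w)
      S-σ {x} x∈ = trans (S-split x) (cong (q x +_)
        (trans (wsum-cong b (inc-spoke (v≢σ x∈))) (wsum-linear (δ x) (δ w) (δ a x) b σ)))

      S-key : ∀ {x} → x ∈ σ → S x ≡ key x + pos x
      S-key {x} x∈ = trans (S-σ x∈) (trans (cong (λ z → q x + (pos x + δ a x * z)) pos-w)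
        (trans (cong (q x +_) (+-comm (pos x) _)) (sym (+-assoc (q x) _ (pos x)))))

      top : ℕ
      top = wsum (λ _ → 1) b σ

      2top : 2 * top + (3 + j) ≡ (3 + j) * (2 * suc l + (3 + j))
      2top = subst (λ k → 2 * top + k ≡ k * (2 * suc l + k)) length-σ (wsum-const b σ)

      low-avoids-hub : ∀ {e} → e ∈ low → ¬ Incident G v e
      low-avoids-hub i with ∈-++⁻ inner i
      ... | inj₁ i₁ = avoids-hub (proj₁ (∈-filter⁻ (λ e → ¬? (incident? G w e)) {xs = avoiding-hub} i₁))
      ... | inj₂ i₂ = avoids-hub (proj₁ (∈-filter⁻ (incident? G w) {xs = avoiding-hub}
                        (proj₁ (∈-filter⁻ (λ e → ¬? (incident? G a e)) {xs = rim-edges} i₂))))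

      -- The only top edge missing `v` is `e∘`; adding its label completes the sum of all top
      -- labels.
      S-hub : S v + pos w ≡ top
      S-hub = begin
        S v + pos w                               ≡⟨ cong (_+ pos w) (S-split v) ⟩
        q v + wsum (I v ∘ spoke) b σ + pos w      ≡⟨ cong (λ m → m + wsum (I v ∘ spoke) b σ + pos w)
                                                      (wsum-zero (I v) 1 low λ {e} i → 𝟙-false (incident? G v e) (low-avoids-hub i)) ⟩
        wsum (I v ∘ spoke) b σ + pos w            ≡⟨ cong (wsum (I v ∘ spoke) b σ +_) (*-identityˡ (pos w)) ⟨
        wsum (I v ∘ spoke) b σ + 1 * pos w        ≡⟨ wsum-linear (I v ∘ spoke) (δ w) 1 b σ ⟨
        wsum (λ y → I v (spoke y) + 1 * δ w y) b σ ≡⟨ wsum-cong b one ⟩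
        top                                       ∎
        where
        open ≡-Reasoning
        one : ∀ {y} → y ∈ σ → I v (spoke y) + 1 * δ w y ≡ 1
        one {y} i with ∈σ⁻ i
        ... | inj₁ refl rewrite spoke-default ¬vw | δ-refl w | 𝟙-false (incident? G v e∘) v∉e∘ = refl
        ... | inj₂ vy rewrite δ-≢ {w} {y} (λ { refl → ¬vw vy })
                            | 𝟙-true (incident? G v (spoke y)) (proj₁ (spoke-incident vy)) = refl

      inc-own : ∀ {x} → x ∈ σ → I x (spoke x) ≡ 1
      inc-own {x} i with ∈σ⁻ i
      ... | inj₁ refl rewrite spoke-default ¬vw = 𝟙-true (incident? G w e∘) w∈e∘
      ... | inj₂ vx = 𝟙-true (incident? G x (spoke x)) (proj₂ (spoke-incident vx))

      -- Every `x` in `σ` meets its own top edge, so at most `suc j` low edges remain for it.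
      q≤ : ∀ {x} → x ∈ σ → q x ≤ suc j * l
      q≤ {x} x∈ = ≤-trans (wsum-upper (I x) 1 low ≤-refl) (*-monoˡ-≤ l (count-low low (map spoke σ) es↭ x (suc j)
        (+-monoˡ-≤ (suc j) (≤-trans (≤-reflexive (sym (inc-own x∈))) (sum-map-∈ (I x) (∈-map⁺ spoke x∈))))))

      pos≤ : ∀ {x} → x ∈ σ → pos x ≤ l + (3 + j)
      pos≤ {x} x∈ = s≤s⁻¹ (subst (λ k → pos x < b + k) length-σ (position-upper b σ σ! x∈))

      a∈σ : a ∈ σ
      a∈σ = end va

      -- Two top edges meet `a`: its own spoke and `e∘`.
      count-a : sum (map (I a) low) ≤ j
      count-a = count-low low (map spoke σ) es↭ a j (+-monoˡ-≤ j two)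
        where
        Ia-w : I a (spoke w) ≡ 1
        Ia-w rewrite spoke-default ¬vw = 𝟙-true (incident? G a e∘) a∈e∘
        two : 2 ≤ sum (map (I a) (map spoke σ))
        two = ≤-trans (≤-reflexive (sym (cong₂ _+_ (inc-own a∈σ) Ia-w)))
          (≤-trans (sum-map-∈² (I a ∘ spoke) a∈σ w∈σ (≢-sym w≢a)) (≤-reflexive (cong sum (map-∘ σ))))

      -- The edges in `rim-rest` avoid `a`, so the low labels at `a` all come from `inner`.
      q-a : q a ≤ j * length inner
      q-a = begin
        q a                                                 ≡⟨ wsum-++ (I a) 1 inner rim-rest ⟩
        wsum (I a) 1 inner + wsum (I a) (1 + length inner) rim-rest ≡⟨ cong (wsum (I a) 1 inner +_) (wsum-zero (I a) (1 + length inner) rim-rest λ {e} i →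
             𝟙-false (incident? G a e) (proj₂ (∈-filter⁻ (λ e → ¬? (incident? G a e)) {xs = rim-edges} i))) ⟩
        wsum (I a) 1 inner + 0                              ≡⟨ +-identityʳ _ ⟩
        wsum (I a) 1 inner                                  ≤⟨ wsum-upper (I a) 1 inner ≤-refl ⟩
        sum (map (I a) inner) * length inner                ≤⟨ *-monoˡ-≤ (length inner) (≤-trans count-inner count-a) ⟩
        j * length inner                                    ∎
        where
        open ≤-Reasoning
        count-inner : sum (map (I a) inner) ≤ sum (map (I a) low)
        count-inner = subst (sum (map (I a) inner) ≤_)
          (sym (trans (cong sum (map-++ (I a) inner rim-rest)) (sum-++ (map (I a) inner) (map (I a) rim-rest))))
          (m≤m+n (sum (map (I a) inner)) (sum (map (I a) rim-rest)))

      inner≤l : length inner ≤ l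
      inner≤l = subst (length inner ≤_) (sym (length-++ inner)) (m≤m+n (length inner) (length rim-rest))

      -- The edges in `inner` avoid `w`, so a nonzero partial sum at `w` needs an edge in
      -- `rim-rest`.
      inner<l : q w ≢ 0 → length inner < l
      inner<l qw≢0 with empty? rim-rest
      ... | inj₂ 0<rim-rest = subst (length inner <_) (sym (length-++ inner)) (m<m+n (length inner) 0<rim-rest)
      ... | inj₁ rim-rest≡[] = ⊥-elim (qw≢0 (trans (wsum-++ (I w) 1 inner rim-rest) (cong₂ _+_
              (wsum-zero (I w) 1 inner λ {e} i → 𝟙-false (incident? G w e)
                (proj₂ (∈-filter⁻ (λ e → ¬? (incident? G w e)) {xs = avoiding-hub} i)))
              (cong (wsum (I w) (1 + length inner)) rim-rest≡[]))))

      S-w : S w ≡ q w + pos w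
      S-w = trans (S-σ w∈σ) (cong (q w +_) (trans (cong (λ m → pos w + m * pos w) (δ-≢ (≢-sym w≢a))) (+-identityʳ _)))

      S-a : S a ≡ q a + (pos a + pos w)
      S-a = trans (S-σ a∈σ) (cong (λ m → q a + (pos a + m)) (trans (cong (_* pos w) (δ-refl a)) (*-identityˡ _)))

      S-end : ∀ {x} → x ∈ σ → a ≢ x → S x ≡ q x + pos x
      S-end {x} x∈ a≢x = trans (S-σ x∈) (cong (q x +_) (trans (cong (λ m → pos x + m * pos w) (δ-≢ a≢x)) (+-identityʳ _)))

      -- With `w` last, its key and its position are both greatest, so only `S w < S v` remains to
      -- be shown.
      hub-distinct-last : B ≡ [] → ∀ {x} → x ∈ σ → S x < S v
      hub-distinct-last B≡[] {x} x∈ = ≤-<-trans (S≤Sw x∈) Sw<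
        where
        length-A : length A ≡ 2 + j
        length-A = trans (sym (trans (cong (λ ys → length A + length ys) B≡[]) (+-identityʳ _))) length-AB

        pos-w-last : pos w ≡ l + (3 + j)
        pos-w-last = trans pos-w (trans (cong (b +_) length-A) (sym (+-suc l (2 + j))))

        ∈A : ∀ {x} → x ∈ σ → x ≢ w → x ∈ A
        ∈A i x≢w with ∈-++⁻ A i
        ... | inj₁ i′ = i′
        ... | inj₂ (here x≡w) = ⊥-elim (x≢w x≡w)
        ... | inj₂ (there i′) with () ← subst (_ ∈_) B≡[] i′

        key≤ : ∀ {x} → x ∈ σ → x ≢ w → key x ≤ key w
        key≤ i x≢w = AllPairs-++-mid A σ↗ (∈A i x≢w)

        S≤Sw : ∀ {x} → x ∈ σ → S x ≤ S w
        S≤Sw {x} i with x ≟ w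
        ... | yes refl = ≤-refl
        ... | no x≢w = subst₂ _≤_ (sym (S-key i)) (sym (S-key w∈σ))
          (+-mono-≤ (key≤ i x≢w) (≤-trans (pos≤ i) (≤-reflexive (sym pos-w-last))))

        a-key : b + length A ≤ q w
        a-key = ≤-trans (≤-trans (≤-reflexive (sym (*-identityˡ _)))
            (≤-trans (≤-reflexive (cong (_* (b + length A)) (sym (δ-refl a)))) (m≤n+m _ (q a))))
          (≤-trans (key≤ a∈σ (≢-sym w≢a)) (≤-reflexive (trans (cong (λ m → q w + m * (b + length A)) (δ-≢ (≢-sym w≢a))) (+-identityʳ _))))

        -- The key of `a` contains the label of `e∘` and is at most `q w`, so `q w` exceeds `l`. For
        -- `j = 0` it would be at most `l`.
        0<j : 0 < j
        0<j = n≢0⇒n>0 λ j≡0 → <⇒≱ (s≤s (≤-trans (q≤ w∈σ) (≤-reflexive (trans (cong (λ i → suc i * l) j≡0) (*-identityˡ l)))))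
          (≤-trans (m≤m+n b (length A)) a-key)

        Sw< : S w < S v
        Sw< = subst (_< S v) (sym S-w) (rim-below-last {j} {l} 2top S-hub (q≤ w∈σ) (pos≤ w∈σ) 0<j)

      hub-or-σ : ∀ x → x ≡ v ⊎ x ∈ σ
      hub-or-σ x with cover x
      ... | inj₁ x≡v         = inj₁ x≡v
      ... | inj₂ (inj₁ refl) = inj₂ w∈σ
      ... | inj₂ (inj₂ vx)   = inj₂ (end vx)

      pos-w≤ : 0 < length B → pos w ≤ l + (2 + j)
      pos-w≤ 0<B = ≤-trans (≤-reflexive pos-w) (≤-trans (≤-reflexive (sym (+-suc l (length A))))
        (+-monoʳ-≤ l (≤-trans (≤-trans (≤-reflexive (+-comm 1 (length A))) (+-monoʳ-≤ (length A) 0<B)) (≤-reflexive length-AB))))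

      qw≢0 : 0 < length A → q w ≢ 0
      qw≢0 0<A qw≡0 = <⇒≢ 0<A (sym (cong length (qw≡0⇒A≡[] qw≡0)))

      hub-distinct : ∀ {x} → x ∈ σ → S x ≢ S v
      hub-distinct {x} x∈ with x ≟ w | a ≟ x
      ... | no x≢w | no a≢x = <⇒≢ (subst (_< S v) (sym (S-end x∈ a≢x))
            (spoke-end-below {j} {l} 2top S-hub (q≤ x∈) (pos≤ x∈) (pos≤ w∈σ) (position-injective b σ! x∈ w∈σ x≢w)))
      ... | yes refl | _ with empty? B
      ...   | inj₁ B≡[] = <⇒≢ (hub-distinct-last B≡[] x∈)
      ...   | inj₂ 0<B  = <⇒≢ (subst (_< S v) (sym S-w) (rim-below {j} {l} 2top S-hub (q≤ w∈σ) (pos-w≤ 0<B)))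
      hub-distinct {x} x∈ | no _ | yes refl with empty? A | empty? B
      ...   | _ | inj₁ B≡[] = <⇒≢ (hub-distinct-last B≡[] x∈)
      -- `w` comes first, so `e∘` has the smallest top label `suc l`.
      ...   | inj₁ A≡[] | inj₂ _ = <⇒≢ (subst (_< S v) (sym S-a) (anchor-below-first {j} {l} 2top S-hub
              (≤-trans q-a (*-monoʳ-≤ j inner≤l)) (pos≤ a∈σ)
              (trans pos-w (trans (cong (λ xs → b + length xs) A≡[]) (+-identityʳ b)))))
      -- As `A` is nonempty, `q w` is nonzero, which gives the strict bound `inner<l`.
      ...   | inj₂ 0<A | inj₂ 0<B with 0 <? j
      ...     | yes 0<j = <⇒≢ (subst (_< S v) (sym S-a) (anchor-below {j} {l} 2top S-hub q-a (inner<l (qw≢0 0<A))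
                (pos≤ a∈σ) (pos-w≤ 0<B) 0<j))
      -- With two spokes the sum at `a` can exceed that at the hub, so the two are only shown to
      -- differ.
      ...     | no j≯0 = λ eq → anchor-distinct {l} (subst (λ i → 2 * top + (3 + i) ≡ (3 + i) * (2 * suc l + (3 + i))) j≡0 2top)
                S-hub pos-w≡ (position-injective b σ! a∈σ w∈σ (≢-sym w≢a)) (trans (sym (trans S-a (cong (_+ (pos a + pos w)) q-a≡0))) eq)
        where
        j≡0 : j ≡ 0
        j≡0 = n≤0⇒n≡0 (≮⇒≥ j≯0)
        q-a≡0 : q a ≡ 0
        q-a≡0 = n≤0⇒n≡0 (≤-trans q-a (≤-reflexive (cong (_* length inner) j≡0)))
        -- For `j = 0` both `A` and `B` have one element, so `w` gets the middle one of three top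
        -- labels.
        pos-w≡ : pos w ≡ l + 2
        pos-w≡ = ≤-antisym (≤-trans (pos-w≤ 0<B) (≤-reflexive (cong (λ i → l + (2 + i)) j≡0)))
          (≤-trans (≤-reflexive (+-suc l 1)) (≤-trans (+-monoʳ-≤ b 0<A) (≤-reflexive (sym pos-w))))

      injective : ∀ x y → S x ≡ S y → x ≡ y
      injective x y eq with hub-or-σ x | hub-or-σ y
      ... | inj₁ refl | inj₁ refl = refl
      ... | inj₁ refl | inj₂ y∈   = ⊥-elim (hub-distinct y∈ (sym eq))
      ... | inj₂ x∈   | inj₁ refl = ⊥-elim (hub-distinct x∈ eq)
      ... | inj₂ x∈   | inj₂ y∈   with x ≟ y
      ...   | yes x≡y = x≡y
      ...   | no  x≢y = ⊥-elim (key+position-injective key b σ! σ↗ x∈ y∈ x≢y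
                (trans (sym (S-key x∈)) (trans eq (S-key y∈))))

      antimagic : Antimagic G
      antimagic = ordering⇒antimagic G es↭ (λ {x} {y} → injective x y)

    anchored⇒antimagic : Antimagic G
    anchored⇒antimagic =
      let A , B , AB↭ , σ↗ , qw≡0⇒A≡[] = sort-around _≟_ q b neighbours! (∈-neighbours⁺ va) w≢a
      in Arranged.antimagic A B AB↭ σ↗ qw≡0⇒A≡[]

  -- Choice of the construction and conclusion.

  antimagic : Edge G → Antimagic G
  antimagic e with incidentEdges G w in eq
  -- The edge `e` serves as the default value of `spoke`.
  ... | [] = isolated⇒antimagic e λ e′ w∈e′ →
        ∉[] (subst (e′ ∈_) eq (∈-filter⁺ (incident? G w) (edges-complete G e′) w∈e′))
  ... | e∘ ∷ _
    with _ , w∈e∘ ← ∈-filter⁻ (incident? G w) {xs = edges G} (subst (e∘ ∈_) (sym eq) (here refl))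
    with a , w≢a , a∈e∘ , wa ← other-endpoint G {e = e∘} w∈e∘
    with cover a
  ... | inj₁ refl        = ⊥-elim (¬vw (symmetric wa))
  ... | inj₂ (inj₁ a≡w)  = ⊥-elim (w≢a (sym a≡w))
  ... | inj₂ (inj₂ va)   = anchored⇒antimagic {e∘ = e∘} w≢a w∈e∘ a∈e∘ va

lemma4p3 : (n : ℕ) (G : Graph n) → 4 ≤ n → Δ G ≡ n ∸ 2 → 2 * n ∸ 4 ≤ size G → Antimagic G
lemma4p3 _ G (s≤s (s≤s (s≤s (s≤s z≤n)))) Δ≡ _ =
  -- Matching on `4 ≤ n` makes `n ∸ 2` compute to the form `2 + j` with `j = n ∸ 4`.
  let v , deg-v = max-degree-attained G (subst (0 <_) (sym Δ≡) (s≤s z≤n))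
      e , _ = nonempty (incidentEdges G v) (trans deg-v Δ≡)
      w , v≢w , ¬vw , cover = Spokes.sole-non-neighbour G v e (cong (2 +_) (sym (trans deg-v Δ≡)))
  in Labelings.antimagic G (trans deg-v Δ≡) (λ x → ≤-trans (degree≤Δ G x) (≤-reflexive Δ≡)) v≢w ¬vw cover e
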